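{- Let $m,\delta\in\mathbb N=\{1,2,\ldots\}$. Consider additive sink subtraction with subtraction set $S(m,\delta)=\{m,\;m+\delta,\;2m+\delta\}$, and let $d$ be the residue of $\delta$ modulo $2m$ with $0\le d<2m$. Then the sequence of nim-values $(v(x))_{x\ge 1}$ is purely periodic, with period length $$p(m,\delta)=\begin{cases}3m+2\delta-d, & \text{if } 0\le d\le m,\\[2pt] \dfrac{m(m+2\delta+d)}{\gcd(m,d)}, & \text{otherwise (i.e. if } m<d<2m).\end{cases}$$
   Context: Sink subtraction with finite subtraction set $S\subset\mathbb N$ is the following two-player impartial game under normal play (a player who cannot move loses). Positions are integers. Every non-positive integer is terminal (these positions form the "sink"; no move is possible from them). From any position $x\ge 1$, for every $s\in S$, the position $x-s\in\mathbb Z$ is an option (moves to non-positive integers are allowed). The nim-value is defined by $v(x)=0$ for all $x\le 0$, and $v(x)=\mathrm{mex}\{v(x-s): s\in S\}$ for $x\ge 1$, where $\mathrm{mex}\,X=\min(\mathbb N_0\setminus X)$ for finite $X\subset\mathbb N_0=\mathbb N\cup\{0\}$. The nim-sequence is $v(1),v(2),v(3),\ldots$ (it starts at $x=1$). The sequence $(v(x))_{x\ge1}$ is purely periodic with period length $p\ge 1$ if $v(x+p)=v(x)$ for all $x\ge 1$ and $p$ is the least positive integer with this property. -}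

module Defs where

open import Data.Bool.Base using (if_then_else_)
open import Data.Integer.Base as ℤ using (ℤ; +_; -[1+_]; +[1+_]; 0ℤ; 1ℤ; ∣_∣)
import Data.Integer.Properties as ℤ
open import Data.List.Base using (List; []; _∷_; map)
open import Data.List.Extrema.Nat using (max; xs≤max)
open import Data.List.Membership.Propositional using (_∈_; _∉_)
open import Data.List.Relation.Unary.All as All using (All; []; _∷_)
open import Data.Nat.Base
open import Data.Nat.DivMod using (_/_; _%_)
open import Data.Nat.GCD using (gcd; gcd[m,n]≢0)
open import Data.Nat.Properties
open import Data.List.Membership.DecPropositional _≟_ using (_∈?_)
open import Data.Product.Base using (_×_)
open import Data.Sum.Base using (inj₁)
open import Relation.Binary.PropositionalEquality
open import Relation.Nullary using (yes; no; contradiction; ⌊_⌋)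

-- Linear search: the least k ≥ n with k ∉ xs, inspecting at most f candidates.
mexFrom : ℕ → ℕ → List ℕ → ℕ
mexFrom n zero    xs = n
mexFrom n (suc f) xs with n ∈? xs
... | yes _ = mexFrom (suc n) f xs
... | no  _ = n

-- suc (max 0 xs) never occurs in xs, so the search always succeeds;
-- mex-∉ and mex-least show that the result is min (ℕ ∖ xs).
mex : List ℕ → ℕ
mex xs = mexFrom 0 (suc (max 0 xs)) xs

mexFrom-∉ : ∀ n f xs → n + f ∉ xs → mexFrom n f xs ∉ xs
mexFrom-∉ n zero    xs n+f∉xs = subst (_∉ xs) (+-identityʳ n) n+f∉xs
mexFrom-∉ n (suc f) xs n+f∉xs with n ∈? xs
... | yes _    = mexFrom-∉ (suc n) f xs (subst (_∉ xs) (+-suc n f) n+f∉xs)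
... | no  n∉xs = n∉xs

mexFrom-least : ∀ n f xs {k} → n ≤ k → k < mexFrom n f xs → k ∈ xs
mexFrom-least n zero    xs n≤k k<n = contradiction k<n (≤⇒≯ n≤k)
mexFrom-least n (suc f) xs {k} n≤k k<mex with n ∈? xs
... | no  _    = contradiction k<mex (≤⇒≯ n≤k)
... | yes n∈xs with n ≟ k
...   | yes refl = n∈xs
...   | no  n≢k  = mexFrom-least (suc n) f xs (≤∧≢⇒< n≤k n≢k) k<mex

mex-∉ : ∀ xs → mex xs ∉ xs
mex-∉ xs = mexFrom-∉ 0 (suc (max 0 xs)) xs
  (λ 1+max∈xs → 1+n≰n (All.lookup (xs≤max 0 xs) 1+max∈xs))

mex-least : ∀ xs {k} → k < mex xs → k ∈ xs
mex-least xs = mexFrom-least 0 (suc (max 0 xs)) xs z≤n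

options : List ℕ → ℤ → List ℤ
options S x = map (λ s → x ℤ.- + s) S

-- The first argument bounds the recursion depth.
nimValueUpTo : ℕ → List ℕ → ℤ → ℕ
nimValueUpTo k       S (+ zero)  = 0
nimValueUpTo k       S -[1+ n ]  = 0
nimValueUpTo zero    S +[1+ n ]  = 0
nimValueUpTo (suc k) S +[1+ n ]  =
  mex (map (nimValueUpTo k S) (options S +[1+ n ]))

-- Depth ∣ x ∣ suffices when all elements of S are positive; the defining
-- recursion of the nim-value is nimValue-sink together with nimValue-mex.
nimValue : List ℕ → ℤ → ℕ
nimValue S x = nimValueUpTo ∣ x ∣ S x

private
  option-≤ : ∀ {n k} s .{{_ : NonZero s}} → n ≤ k → +[1+ n ] ℤ.- + s ℤ.≤ + k
  option-≤ {n} {k} (suc s) n≤k = subst (ℤ._≤ + k) (sym (ℤ.[1+m]⊖[1+n]≡m⊖n n s))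
    (ℤ.≤-trans (ℤ.m⊖n≤m n s) (ℤ.+≤+ n≤k))

  x≤∣x∣ : ∀ x → x ℤ.≤ + ∣ x ∣
  x≤∣x∣ (+ n)    = ℤ.≤-refl
  x≤∣x∣ -[1+ n ] = ℤ.-≤+

  nimValueUpTo-stable : ∀ {S} → All NonZero S → ∀ k l x → x ℤ.≤ + k → x ℤ.≤ + l →
                        nimValueUpTo k S x ≡ nimValueUpTo l S x
  nimValueUpTo-stable S>0 k l (+ zero) _ _ = refl
  nimValueUpTo-stable S>0 k l -[1+ n ] _ _ = refl
  nimValueUpTo-stable {S} S>0 (suc k) (suc l) +[1+ n ]
                      (ℤ.+≤+ (s≤s n≤k)) (ℤ.+≤+ (s≤s n≤l)) = cong mex (go S>0)
    where
    go : ∀ {T} → All NonZero T →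
         map (nimValueUpTo k S) (options T +[1+ n ]) ≡
         map (nimValueUpTo l S) (options T +[1+ n ])
    go []                  = refl
    go (_∷_ {x = s} s>0 T>0) = cong₂ _∷_
      (nimValueUpTo-stable S>0 k l _ (option-≤ s {{s>0}} n≤k) (option-≤ s {{s>0}} n≤l))
      (go T>0)

nimValue-sink : ∀ S {x} → x ℤ.≤ 0ℤ → nimValue S x ≡ 0
nimValue-sink S { + zero }  _ = refl
nimValue-sink S { -[1+ n ]} _ = refl
nimValue-sink S { +[1+ n ]} (ℤ.+≤+ ())

nimValue-mex : ∀ {S} → All NonZero S → ∀ {x} → 1ℤ ℤ.≤ x →
               nimValue S x ≡ mex (map (nimValue S) (options S x))
nimValue-mex S>0 { + zero } (ℤ.+≤+ ())
nimValue-mex {S} S>0 { +[1+ n ]} _ = cong mex (go S>0)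
  where
  go : ∀ {T} → All NonZero T →
       map (nimValueUpTo n S) (options T +[1+ n ]) ≡
       map (nimValue S) (options T +[1+ n ])
  go []                    = refl
  go (_∷_ {x = s} s>0 T>0) = cong₂ _∷_
    (nimValueUpTo-stable S>0 n _ (+[1+ n ] ℤ.- + s) (option-≤ s {{s>0}} ≤-refl) (x≤∣x∣ _))
    (go T>0)

IsPeriod : (ℤ → ℕ) → ℕ → Set
IsPeriod v p = ∀ x → 1ℤ ℤ.≤ x → v (x ℤ.+ + p) ≡ v x

PurelyPeriodicWithLength : (ℤ → ℕ) → ℕ → Set
PurelyPeriodicWithLength v p =
  1 ≤ p × IsPeriod v p × (∀ q → 1 ≤ q → IsPeriod v q → p ≤ q)

additiveSet : ℕ → ℕ → List ℕ
additiveSet m δ = m ∷ m + δ ∷ 2 * m + δ ∷ []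

residue : (m δ : ℕ) .{{_ : NonZero m}} → ℕ
residue m δ = _%_ δ (2 * m) {{m*n≢0 2 m}}

-- The truncated subtraction is exact since d ≤ δ, and the floor division is
-- exact since gcd m d divides m.
periodLength : (m δ : ℕ) .{{_ : NonZero m}} → ℕ
periodLength m δ =
  if ⌊ d ≤? m ⌋
  then 3 * m + 2 * δ ∸ d
  else _/_ (m * (m + 2 * δ + d)) (gcd m d)
         {{≢-nonZero (gcd[m,n]≢0 m d (inj₁ (≢-nonZero⁻¹ m)))}}
  where
  d : ℕ
  d = residue m δ

{-# OPTIONS --safe #-}

-- Put a = m and b = m + δ, so that S = {a, b, a + b}. Along each residue class
-- modulo a the values form runs 1 2 1 2 … 1 2, each followed by a run
-- 3 0 3 0 … 3 0 or 0 3 0 3 0 … 3 0. Number the runs of a class by phases: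
-- phase 2k is the k-th 12-run, phase 2k + 1 the 03-run after it. A 12-run
-- begins exactly b after a 03-run has begun in the class shifted by b, and the
-- k-th 12-runs begin at residues modulo 2a filling a cyclic interval of length
-- a that moves by b with k. Hence there is an explicit F k, increasing by a
-- when its argument does, such that phase 2k begins when F k reaches a
-- threshold c k, and within a run the value is determined by the parity of
-- ⌊F k / a⌋. Given this, the mex rule is a finite case check.
--
-- The period is the least shift that preserves F and c: by aligned, a block of
-- a consecutive positions at which a 12-run begins can only sit at a multiple
-- of it. If d ≤ m then 2b + (m − d) is such a shift. If d > m, every shift by
-- w = 2b + (d − m) displaces the pattern by d − m inside blocks of length m,
-- so w must be repeated m / gcd(m, d) times.
module Submission where

open import Defs
open import Data.Bool.Base using (Bool; true; false; not)
open import Data.Bool.Properties using (not-involutive)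
open import Data.Integer.Base as ℤ using (+[1+_])
import Data.Integer.Properties as ℤ
open import Data.List.Base using ([]; _∷_)
open import Data.List.Relation.Unary.All using ([]; _∷_)
open import Data.Nat.Base
open import Data.Nat.Coprimality using (coprime-divisor; coprime-/gcd)
open import Data.Nat.Divisibility
open import Data.Nat.DivMod hiding (result)
open import Data.Nat.GCD
open import Data.Nat.Induction using (<-rec)
open import Data.Nat.Properties
open import Algebra.Properties.CommutativeSemigroup +-commutativeSemigroup
  using () renaming (xy∙z≈xz∙y to swap)
open import Data.Nat.Tactic.RingSolver using (solve-∀)
open import Data.Product.Base using (∃-syntax; _×_; _,_; proj₁; proj₂)
open import Data.Sum.Base using (_⊎_; inj₁; inj₂)
open import Function.Base using (_∘_; _⟨_⟩_)
open import Relation.Binary.Definitions using (tri<; tri≈; tri>)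
open import Relation.Binary.PropositionalEquality hiding (J)
open import Relation.Nullary using (¬_; Dec; yes; no; contradiction)

-- Parity of blocks of length `a`.

even : ℕ → Bool
even zero    = true
even (suc n) = not (even n)

module _ (a : ℕ) .{{_ : NonZero a}} where

  evenBlock : ℕ → Bool
  evenBlock n = even (n / a)

  [m+a]/a≡1+m/a : ∀ m → (m + a) / a ≡ suc (m / a)
  [m+a]/a≡1+m/a m = begin
    (m + a) / a    ≡⟨ +-distrib-/-∣ʳ m ∣-refl ⟩
    m / a + a / a  ≡⟨ cong (m / a +_) (n/n≡1 a) ⟩
    m / a + 1      ≡⟨ +-comm (m / a) 1 ⟩
    suc (m / a)    ∎
    where open ≡-Reasoning

  evenBlock-+a : ∀ m → evenBlock (m + a) ≡ not (evenBlock m)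
  evenBlock-+a m = cong even ([m+a]/a≡1+m/a m)

  evenBlock-+2ta : ∀ m t → evenBlock (m + t * (2 * a)) ≡ evenBlock m
  evenBlock-+2ta m zero    = cong evenBlock (+-identityʳ m)
  evenBlock-+2ta m (suc t) = begin
    evenBlock (m + suc t * (2 * a))          ≡⟨ cong evenBlock (rearrange m t a) ⟩
    evenBlock (m + t * (2 * a) + a + a)      ≡⟨ evenBlock-+a _ ⟩
    not (evenBlock (m + t * (2 * a) + a))    ≡⟨ cong not (evenBlock-+a _) ⟩
    not (not (evenBlock (m + t * (2 * a))))  ≡⟨ not-involutive _ ⟩
    evenBlock (m + t * (2 * a))              ≡⟨ evenBlock-+2ta m t ⟩
    evenBlock m                              ∎
    where
    open ≡-Reasoning
    rearrange : ∀ m t a → m + suc t * (2 * a) ≡ m + t * (2 * a) + a + a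
    rearrange = solve-∀

  evenBlock-cong : ∀ {m n} s t → m + s * (2 * a) ≡ n + t * (2 * a) →
                   evenBlock m ≡ evenBlock n
  evenBlock-cong {m} {n} s t eq =
    trans (sym (evenBlock-+2ta m s)) (trans (cong evenBlock eq) (evenBlock-+2ta n t))

  evenBlock-window : ∀ {m} t → t * (2 * a) ≤ m → m < t * (2 * a) + a →
                     evenBlock m ≡ true
  evenBlock-window {m} t c≤m m<c+a = begin
    evenBlock m                        ≡⟨ cong evenBlock (m∸n+n≡m c≤m) ⟨
    evenBlock (m ∸ c + c)              ≡⟨ evenBlock-+2ta (m ∸ c) t ⟩
    even ((m ∸ c) / a)                 ≡⟨ cong even (m<n⇒m/n≡0 m∸c<a) ⟩
    true                               ∎
    where
    open ≡-Reasoning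
    c = t * (2 * a)
    m∸c<a : m ∸ c < a
    m∸c<a = +-cancelʳ-< c (m ∸ c) a
      (subst₂ _<_ (sym (m∸n+n≡m c≤m)) (+-comm c a) m<c+a)

-- Phase systems.

-- Position x of the game is n = x − 1 + origin, so that a position and all its
-- options are natural numbers. E k n says that n has phase at least 2k, and
-- O k n that it has phase at least 2k + 1.
record PhaseSystem (a : ℕ) .{{_ : NonZero a}} (b p : ℕ) : Set where
  field
    F     : ℕ → ℕ → ℕ
    L     : ℕ → ℕ
    ε K-1 : ℕ

  K : ℕ
  K = suc K-1

  c : ℕ → ℕ
  c k = L k * (2 * a)

  E : ℕ → ℕ → Set
  E k n = c k ≤ F k n

  O : ℕ → ℕ → Set
  O k n = E (suc k) (n + b)

  J : ℕ → ℕ → Bool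
  J k n = evenBlock a (F k n)

  origin : ℕ
  origin = c 0

  field
    a≤b      : a ≤ b
    a≤p      : a ≤ p
    a+b≤o    : a + b ≤ origin
    ε≤a      : ε ≤ a
    F-+a     : ∀ k n → F k (n + a) ≡ F k n + a
    -- In subtraction-free form: `2 b` further on and one `k` later, the excess of `F` over its
    -- threshold has dropped by `ε`. As `ε ≤ a`, one step of `a` makes up for the loss.
    F-+2b    : ∀ k n → F (suc k) (n + b + b) + ε + c k ≡ F k n + c (suc k)
    J-+b     : ∀ k n → J (suc k) (n + b) ≡ J k n
    -- The bound on `s` says `s ≥ b - a`. Shorter shifts are left out because for d > m the function
    -- `F k` reverses blocks and need not be monotone.
    E-+      : ∀ k n s → b ≤ a + s → E k n → E k (n + s)
    E₀⇒      : ∀ {n} → E 0 n → origin ≤ n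
    ⇒E₀      : ∀ {n} → origin ≤ n → E 0 n
    F-+p     : ∀ k n → F (K + k) (n + p) + c k ≡ F k n + c (K + k)
    -- `n` and `m` are the two ends of `a` consecutive positions, and their classes reach phase
    -- `2 k` exactly at `n + a` and `m + a`. Minimality of the period rests on this.
    aligned  : ∀ k {n m} → suc m ≡ n + a →
               E k (n + a) → ¬ E k n → E k (m + a) → ¬ E k m →
               ∃[ t ] n + a ≡ origin + t * p

  -- Order of the phases, and parity where they begin.

  E? : ∀ k n → Dec (E k n)
  E? k n = c k ≤? F k n

  J-+a : ∀ k n → J k (n + a) ≡ not (J k n)
  J-+a k n = trans (cong (evenBlock a) (F-+a k n)) (evenBlock-+a a (F k n))

  J-+p : ∀ k n → J (K + k) (n + p) ≡ J k n
  J-+p k n = evenBlock-cong a (L k) (L (K + k)) (F-+p k n)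

  E-+a : ∀ k n → E k n → E k (n + a)
  E-+a k n e = ≤-trans e (≤-trans (m≤m+n _ a) (≤-reflexive (sym (F-+a k n))))

  E-+b : ∀ k n → E k n → E k (n + b)
  E-+b k n = E-+ k n b (m≤n+m b a)

  -- From `n + a` to `n + b` is the shortest shift that `E-+` allows.
  E-+a⇒+b : ∀ k n → E k (n + a) → E k (n + b)
  E-+a⇒+b k n e = subst (E k) eq (E-+ k (n + a) (b ∸ a) (m≤n+m∸n b a) e)
    where
    eq : n + a + (b ∸ a) ≡ n + b
    eq = trans (+-assoc n a _) (cong (n +_) (m+[n∸m]≡n a≤b))

  E⇒+a+2b : ∀ k n → E k n → E (suc k) (n + b + b + a)
  E⇒+a+2b k n e = subst (c (suc k) ≤_) (sym (F-+a (suc k) (n + b + b)))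
    (≤-trans (+-cancelʳ-≤ (c k) _ _ (begin
      c (suc k) + c k                       ≡⟨ +-comm (c (suc k)) _ ⟩
      c k + c (suc k)                       ≤⟨ +-monoˡ-≤ _ e ⟩
      F k n + c (suc k)                     ≡⟨ F-+2b k n ⟨
      F (suc k) (n + b + b) + ε + c k       ∎))
    (+-monoʳ-≤ _ ε≤a))
    where open ≤-Reasoning

  +2b⇒E : ∀ k n → E (suc k) (n + b + b) → E k n
  +2b⇒E k n e = +-cancelʳ-≤ (c (suc k)) _ _ (begin
    c k + c (suc k)                    ≤⟨ +-monoʳ-≤ (c k) e ⟩
    c k + F (suc k) (n + b + b)        ≡⟨ +-comm (c k) _ ⟩
    F (suc k) (n + b + b) + c k        ≤⟨ +-monoˡ-≤ (c k) (m≤m+n _ ε) ⟩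
    F (suc k) (n + b + b) + ε + c k    ≡⟨ F-+2b k n ⟩
    F k n + c (suc k)                  ∎)
    where open ≤-Reasoning

  -- Trading the step `a` for a step `b` reduces this to `+2b⇒E`. It bounds how far the longest move
  -- can fall in `k`.
  +a+b⇒E : ∀ k n → E (suc k) (n + a + b) → E k n
  +a+b⇒E k n e = +2b⇒E k n (E-+a⇒+b (suc k) (n + b) (subst (E (suc k)) (swap n a b) e))

  O⇒E : ∀ k n → O k n → E k n
  O⇒E k n e = +2b⇒E k n (E-+b (suc k) (n + b) e)

  E-suc⇒O : ∀ k n → E (suc k) n → O k n
  E-suc⇒O k n = E-+b (suc k) n

  E-suc⇒E : ∀ k n → E (suc k) n → E k n
  E-suc⇒E k n e = O⇒E k n (E-suc⇒O k n e)

  E-anti : ∀ {j k} n → j ≤ k → E k n → E j n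
  E-anti {j} {zero}  n z≤n   e = e
  E-anti {j} {suc k} n j≤1+k e with m≤n⇒m<n∨m≡n j≤1+k
  ... | inj₁ (s≤s j≤k) = E-anti n j≤k (E-suc⇒E k n e)
  ... | inj₂ refl      = e

  E⇒origin≤ : ∀ k {n} → E k n → origin ≤ n
  E⇒origin≤ k {n} e = E₀⇒ (E-anti n z≤n e)

  -- The step of `a` that crosses the threshold ends less than `a` beyond it, and the threshold is a
  -- multiple of `2 a`. So every 12-run begins with 1.
  J-start : ∀ k n → E k (n + a) → ¬ E k n → J k (n + a) ≡ true
  J-start k n e ¬e = evenBlock-window a (L k) e
    (subst (_< c k + a) (sym (F-+a k n)) (+-monoˡ-< a (≰⇒> ¬e)))

  -- One step of `a` earlier the parity is opposite, so every 03-run ends with 0.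
  J-before-start : ∀ k n → E k (n + a) → ¬ E k n → J k n ≡ false
  J-before-start k n e ¬e = begin
    J k n              ≡⟨ not-involutive _ ⟨
    not (not (J k n))  ≡⟨ cong not (J-+a k n) ⟨
    not (J k (n + a))  ≡⟨ cong not (J-start k n e ¬e) ⟩
    false              ∎
    where open ≡-Reasoning

  -- By `F-+2b`, missing the next threshold bounds the excess of `F k n` by `ε ≤ a`, so `n` is still
  -- in the first block after the threshold.
  J-early : ∀ k n → E k n → ¬ E (suc k) (n + b + b) → J k n ≡ true
  J-early k n e ¬e = evenBlock-window a (L k) e (+-cancelʳ-< (c (suc k)) _ _ (begin-strict
    F k n + c (suc k)                   ≡⟨ F-+2b k n ⟨
    F (suc k) (n + b + b) + ε + c k     ≡⟨ +-assoc _ ε (c k) ⟩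
    F (suc k) (n + b + b) + (ε + c k)   <⟨ +-monoˡ-< _ (≰⇒> ¬e) ⟩
    c (suc k) + (ε + c k)               ≤⟨ +-monoʳ-≤ (c (suc k)) (+-monoˡ-≤ (c k) ε≤a) ⟩
    c (suc k) + (a + c k)               ≡⟨ rearrange (c (suc k)) a (c k) ⟩
    c k + a + c (suc k)                 ∎))
    where
    open ≤-Reasoning
    rearrange : ∀ x y z → x + (y + z) ≡ z + y + x
    rearrange = solve-∀

  E-+p : ∀ k n → E k n → E (K + k) (n + p)
  E-+p k n e = +-cancelʳ-≤ (c k) _ _ (begin
    c (K + k) + c k           ≡⟨ +-comm (c (K + k)) _ ⟩
    c k + c (K + k)           ≤⟨ +-monoˡ-≤ _ e ⟩
    F k n + c (K + k)         ≡⟨ F-+p k n ⟨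
    F (K + k) (n + p) + c k   ∎)
    where open ≤-Reasoning

  E-∸p : ∀ k n → E (K + k) (n + p) → E k n
  E-∸p k n e = +-cancelʳ-≤ (c (K + k)) _ _ (begin
    c k + c (K + k)           ≡⟨ +-comm (c k) _ ⟩
    c (K + k) + c k           ≤⟨ +-monoˡ-≤ _ e ⟩
    F (K + k) (n + p) + c k   ≡⟨ F-+p k n ⟩
    F k n + c (K + k)         ∎)
    where open ≤-Reasoning

-- Nim-values of the phases by the mex rule.

-- The values in phase 2k, as functions of J k, and in phase 2k + 1, as functions
-- of J (suc k).
code₁₂ code₀₃ : Bool → ℕ
code₁₂ true  = 1
code₁₂ false = 2
code₀₃ true  = 3
code₀₃ false = 0

module Values {a b p : ℕ} .{{_ : NonZero a}} (Φ : PhaseSystem a b p)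
  (v : ℕ → ℕ)
  (v-sink : ∀ {n} → n < PhaseSystem.origin Φ → v n ≡ 0)
  (v-mex  : ∀ n → PhaseSystem.origin Φ ≤ n + a + b →
            v (n + a + b) ≡ mex (v (n + b) ∷ v (n + a) ∷ v n ∷ []))
  where

  open PhaseSystem Φ

  Spec : ℕ → Set
  Spec n = (∀ k → E k n → ¬ O k n → v n ≡ code₁₂ (J k n))
         × (∀ k → O k n → ¬ E (suc k) n → v n ≡ code₀₃ (J (suc k) n))

  origin-decomp : ∀ {n} → origin ≤ n → ∃[ y ] n ≡ y + a + b
  origin-decomp {n} o≤n = n ∸ (a + b) ,
    sym (trans (+-assoc _ a b) (m∸n+n≡m (≤-trans a+b≤o o≤n)))

  code-03 : ∀ j {w} → w ≡ code₀₃ j → (j ≡ false → w ≡ 0) × (w ≡ 0 ⊎ w ≡ 3)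
  code-03 true  w≡3 = (λ ()) , inj₂ w≡3
  code-03 false w≡0 = (λ _ → w≡0) , inj₁ w≡0

  module Step (y : ℕ) (o≤x : origin ≤ y + a + b)
              (ih : ∀ {z} → z < y + a + b → Spec z) where

    -- The options of `x` are `y + b`, `y + a` and `y`, at distances `a`, `b` and `a + b`.
    x : ℕ
    x = y + a + b

    a>0 : 0 < a
    a>0 = >-nonZero⁻¹ a

    b>0 : 0 < b
    b>0 = ≤-trans a>0 a≤b

    y+b+a≡x : y + b + a ≡ x
    y+b+a≡x = swap y b a

    y+b<x : y + b < x
    y+b<x = subst (y + b <_) y+b+a≡x (m<m+n (y + b) a>0)

    y+a<x : y + a < x
    y+a<x = m<m+n (y + a) b>0

    y<x : y < x
    y<x = <-≤-trans (m<m+n y a>0) (<⇒≤ y+a<x)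

    -- For k = 0 the run before phase 0 is the sink, where the value is 0
    -- whatever J is.
    low : ∀ k n → n < x → ¬ E k n → E k (n + b) →
          (J k n ≡ false → v n ≡ 0) × (v n ≡ 0 ⊎ v n ≡ 3)
    low zero n n<x ¬e _ = (λ _ → vn≡0) , inj₁ vn≡0
      where vn≡0 = v-sink (≰⇒> (¬e ∘ ⇒E₀))
    low (suc k) n n<x ¬e o = code-03 (J (suc k) n) (proj₂ (ih n<x) k o ¬e)

    J-x : ∀ k → J k x ≡ not (J k (y + b))
    J-x k = trans (cong (J k) (sym y+b+a≡x)) (J-+a k (y + b))

    mex-A₁ : ∀ {u₁ u₂ u₃} → u₁ ≡ 0 → u₂ ≡ 0 ⊎ u₂ ≡ 3 → u₃ ≡ 0 ⊎ u₃ ≡ 2 →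
             mex (u₁ ∷ u₂ ∷ u₃ ∷ []) ≡ 1
    mex-A₁ refl (inj₁ refl) (inj₁ refl) = refl
    mex-A₁ refl (inj₁ refl) (inj₂ refl) = refl
    mex-A₁ refl (inj₂ refl) (inj₁ refl) = refl
    mex-A₁ refl (inj₂ refl) (inj₂ refl) = refl

    mex-A₂ : ∀ j {u₁ u₂ u₃} → u₁ ≡ code₁₂ j → u₂ ≡ 0 ⊎ u₂ ≡ 3 → u₃ ≡ 0 ⊎ u₃ ≡ 3 →
             u₂ ≡ 0 ⊎ u₃ ≡ 0 → mex (u₁ ∷ u₂ ∷ u₃ ∷ []) ≡ code₁₂ (not j)
    mex-A₂ true  refl (inj₁ refl) (inj₁ refl) _ = refl
    mex-A₂ true  refl (inj₁ refl) (inj₂ refl) _ = refl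
    mex-A₂ true  refl (inj₂ refl) (inj₁ refl) _ = refl
    mex-A₂ true  refl (inj₂ refl) (inj₂ refl) (inj₁ ())
    mex-A₂ true  refl (inj₂ refl) (inj₂ refl) (inj₂ ())
    mex-A₂ false refl (inj₁ refl) (inj₁ refl) _ = refl
    mex-A₂ false refl (inj₁ refl) (inj₂ refl) _ = refl
    mex-A₂ false refl (inj₂ refl) (inj₁ refl) _ = refl
    mex-A₂ false refl (inj₂ refl) (inj₂ refl) (inj₁ ())
    mex-A₂ false refl (inj₂ refl) (inj₂ refl) (inj₂ ())

    mex-B : ∀ i j {u₁ u₂ u₃} → u₁ ≡ code₀₃ j → u₂ ≡ code₁₂ (not i) → u₃ ≡ code₁₂ i →
            mex (u₁ ∷ u₂ ∷ u₃ ∷ []) ≡ code₀₃ (not j)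
    mex-B true  true  refl refl refl = refl
    mex-B true  false refl refl refl = refl
    mex-B false true  refl refl refl = refl
    mex-B false false refl refl refl = refl

    mex₃ : ∀ {u₁ u₂ u₃ w₁ w₂ w₃} → u₁ ≡ w₁ → u₂ ≡ w₂ → u₃ ≡ w₃ →
           mex (u₁ ∷ u₂ ∷ u₃ ∷ []) ≡ mex (w₁ ∷ w₂ ∷ w₃ ∷ [])
    mex₃ refl refl refl = refl

    -- For `k = 0`, `y` is in the sink. Otherwise `J-+b` carries the odd parity of `y + b` down to
    -- `y`, which holds the final 2 of the preceding 12-run.
    two-phases-down : ∀ k → E k x → ¬ E k (y + b) → v y ≡ 0 ⊎ v y ≡ 2
    two-phases-down zero    e ¬e =
      inj₁ (v-sink (≰⇒> (¬e ∘ E-+b 0 y ∘ ⇒E₀)))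
    two-phases-down (suc k) e ¬e = inj₂ (begin
      v y           ≡⟨ proj₁ (ih y<x) k (+a+b⇒E k y e) ¬e ⟩
      code₁₂ (J k y) ≡⟨ cong code₁₂ (J-+b k y) ⟨
      code₁₂ (J (suc k) (y + b))
        ≡⟨ cong code₁₂ (J-before-start (suc k) (y + b)
             (subst (E (suc k)) (sym y+b+a≡x) e) ¬e) ⟩
      2             ∎)
      where open ≡-Reasoning

    -- Supplies the option 0 when `y` and `y + a` both lie in a 03-run.
    not-both : ∀ k → J k y ≡ false ⊎ J k (y + a) ≡ false
    not-both k with J k y | J-+a k y
    ... | true  | eq = inj₂ eq
    ... | false | _  = inj₁ refl

    step₁₂ : ∀ k → E k x → ¬ O k x → v x ≡ code₁₂ (J k x)
    step₁₂ k e ¬o with E? k (y + b)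
    -- `x` begins its 12-run: `y + b` ends a 03-run with 0, and no option is 1.
    ... | no ¬e = trans (v-mex y o≤x) (trans
      (mex-A₁ (proj₁ (low k (y + b) y+b<x ¬e E-y+b+b) (J-before-start k (y + b) e′ ¬e))
              (proj₂ (low k (y + a) y+a<x (¬e ∘ E-+a⇒+b k y) e))
              (two-phases-down k e ¬e))
      (cong code₁₂ (sym (trans (cong (J k) (sym y+b+a≡x)) (J-start k (y + b) e′ ¬e)))))
      where
      e′ = subst (E k) (sym y+b+a≡x) e
      E-y+b+b = E-+a⇒+b k (y + b) e′
    ... | yes e-b with E? k (y + a)
    -- `y + b` is in the same 12-run, while `y + a` and `y` precede it and one of them is 0; hence 1
    -- and 2 alternate.
    ...   | no ¬e-a = trans (v-mex y o≤x) (trans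
      (mex-A₂ (J k (y + b)) v-b (proj₂ low-a) (proj₂ low-0) zero-one)
      (cong code₁₂ (sym (J-x k))))
      where
      v-b = proj₁ (ih y+b<x) k e-b
        (¬o ∘ subst (E (suc k)) eq ∘ E-+a (suc k) (y + b + b))
        where
        eq : y + b + b + a ≡ y + a + b + b
        eq = trans (swap (y + b) b a) (cong (_+ b) (swap y b a))
      low-a = low k (y + a) y+a<x ¬e-a e
      low-0 = low k y y<x (¬e-a ∘ E-+a k y) e-b
      zero-one : v (y + a) ≡ 0 ⊎ v y ≡ 0
      zero-one with not-both k
      ... | inj₁ j = inj₂ (proj₁ low-0 j)
      ... | inj₂ j = inj₁ (proj₁ low-a j)
    -- Here `y + a` begins a 12-run and `y` precedes it, since otherwise `E⇒+a+2b` would put `x`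
    -- past its 12-run. The options are 1, 1, 0, and `x` is the final 2.
    ...   | yes e-a = trans (v-mex y o≤x) (trans
      (mex₃ (trans v-b (cong code₁₂ J-y+b)) (trans v-a (cong code₁₂ (J-start k y e-a ¬e-0)))
            (proj₁ (low k y y<x ¬e-0 e-b) (J-before-start k y e-a ¬e-0)))
      (cong code₁₂ (sym (trans (J-x k) (cong not J-y+b)))))
      where
      eq : y + b + b + a ≡ y + a + b + b
      eq = trans (swap (y + b) b a) (cong (_+ b) (swap y b a))
      ¬e-0 : ¬ E k y
      ¬e-0 e-0 = ¬o (subst (E (suc k)) eq (E⇒+a+2b k y e-0))
      ¬o-a : ¬ O k (y + a)
      ¬o-a = ¬o ∘ E-suc⇒O k x
      v-a = proj₁ (ih y+a<x) k e-a ¬o-a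
      v-b = proj₁ (ih y+b<x) k e-b
        (¬o ∘ subst (E (suc k)) eq ∘ E-+a (suc k) (y + b + b))
      J-x-false : J k x ≡ false
      J-x-false = trans (sym (J-+b k x))
        (J-before-start (suc k) (x + b) (E⇒+a+2b k (y + a) e-a) ¬o)
      J-y+b : J k (y + b) ≡ true
      J-y+b = trans (sym (not-involutive _))
        (cong not (trans (sym (J-x k)) J-x-false))

    step₀₃ : ∀ k → O k x → ¬ E (suc k) x → v x ≡ code₀₃ (J (suc k) x)
    step₀₃ k o ¬e with E? (suc k) (y + b + b)
    -- `y + b` is in the same 03-run, and `y`, `y + a` are neighbours in a 12-run, so 1 and 2 are
    -- excluded and 0 and 3 alternate.
    ... | yes o-b = trans (v-mex y o≤x) (trans
      (mex-B (J k y) (J (suc k) (y + b)) v-b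
        (trans v-a (cong code₁₂ (J-+a k y))) v-0)
      (cong code₀₃ (sym (J-x (suc k)))))
      where
      e-0 : E k y
      e-0 = +2b⇒E k y o-b
      v-0 = proj₁ (ih y<x) k e-0
        (¬e ∘ subst (E (suc k)) y+b+a≡x ∘ E-+a (suc k) (y + b))
      v-a = proj₁ (ih y+a<x) k (E-+a k y e-0) ¬e
      v-b = proj₂ (ih y+b<x) k o-b (¬e ∘ subst (E (suc k)) y+b+a≡x ∘ E-+a (suc k) (y + b))
    -- `x` begins its 03-run and `y + b` is the final 2 of the 12-run. Whether `y` has entered that
    -- phase decides the first value: options 2, 2, 1 give 0, and options 2, 1, 0 give 3.
    ... | no ¬o-b = go (E? k y)
      where
      eq : y + a + b + b ≡ y + b + b + a
      eq = trans (cong (_+ b) (swap y a b)) (swap (y + b) a b)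
      e-a : E k (y + a)
      e-a = +2b⇒E k (y + a) o
      e-b : E k (y + b)
      e-b = E-+a⇒+b k y e-a
      J-b : J k (y + b) ≡ false
      J-b = trans (sym (J-+b k (y + b)))
        (J-before-start (suc k) (y + b + b) (subst (E (suc k)) eq o) ¬o-b)
      v-b : v (y + b) ≡ 2
      v-b = trans (proj₁ (ih y+b<x) k e-b ¬o-b) (cong code₁₂ J-b)
      v-a : v (y + a) ≡ code₁₂ (J k (y + a))
      v-a = proj₁ (ih y+a<x) k e-a ¬e
      go : Dec (E k y) → v x ≡ code₀₃ (J (suc k) x)
      go (yes e-0) = trans (v-mex y o≤x) (trans
        (mex₃ v-b (trans v-a (cong code₁₂ J-a)) (trans v-0 (cong code₁₂ J-0)))
        (cong code₀₃ (sym (trans (J-+b k (y + a)) J-a))))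
        where
        J-0 = J-early k y e-0 ¬o-b
        J-a = trans (J-+a k y) (cong not J-0)
        v-0 = proj₁ (ih y<x) k e-0
          (¬e ∘ subst (E (suc k)) y+b+a≡x ∘ E-+a (suc k) (y + b))
      go (no ¬e-0) = trans (v-mex y o≤x) (trans
        (mex₃ v-b (trans v-a (cong code₁₂ J-a))
          (proj₁ (low k y y<x ¬e-0 e-b) (J-before-start k y e-a ¬e-0)))
        (cong code₀₃ (sym (trans (J-+b k (y + a)) J-a))))
        where
        J-a = J-start k y e-a ¬e-0

  spec : ∀ n → Spec n
  spec = <-rec Spec go
    where
    go : ∀ n → (∀ {z} → z < n → Spec z) → Spec n
    go n ih with origin ≤? n
    ... | no  o≰n = (λ k e → contradiction (E⇒origin≤ k e) o≰n)
                  , (λ k o → contradiction (E⇒origin≤ k (O⇒E k n o)) o≰n)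
    ... | yes o≤n with origin-decomp o≤n
    ...   | y , refl = Step.step₁₂ y o≤n ih , Step.step₀₃ y o≤n ih

  -- Period of the values and its minimality.

  v₁₂ : ∀ {n} k → E k n → ¬ O k n → v n ≡ code₁₂ (J k n)
  v₁₂ {n} = proj₁ (spec n)

  v₀₃ : ∀ {n} k → O k n → ¬ E (suc k) n → v n ≡ code₀₃ (J (suc k) n)
  v₀₃ {n} = proj₂ (spec n)

  -- Going down by `a + b` costs at most one `k`. The bound makes the search in `phase` stop.
  E-bound : ∀ k n → E k n → k ≤ n
  E-bound zero    n e = z≤n
  E-bound (suc k) n e with origin-decomp (E⇒origin≤ (suc k) e)
  ... | y , refl = ≤-trans (s≤s (E-bound k y (+a+b⇒E k y e))) (≤-trans
    (m<m+n y (>-nonZero⁻¹ a)) (m≤m+n (y + a) b))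

  data Phase (n : ℕ) : Set where
    phase₁₂ : ∀ k → E k n → ¬ O k n → Phase n
    phase₀₃ : ∀ k → O k n → ¬ E (suc k) n → Phase n

  phase : ∀ {n} → origin ≤ n → Phase n
  phase {n} o≤n = search 0 n (+-identityʳ n) (⇒E₀ o≤n)
    where
    search : ∀ k f → f + k ≡ n → E k n → Phase n
    search k f f+k≡n e with E? (suc k) (n + b) | E? (suc k) n
    ... | no ¬o | _      = phase₁₂ k e ¬o
    ... | yes o | no ¬e′ = phase₀₃ k o ¬e′
    search k zero    refl  e | yes _ | yes e′ =
      contradiction (E-bound (suc k) n e′) 1+n≰n
    search k (suc f) f+k≡n e | yes _ | yes e′ =
      search (suc k) f (trans (+-suc f k) f+k≡n) e′

  periodic : ∀ {n} → origin ≤ n → v (n + p) ≡ v n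
  periodic {n} o≤n with phase o≤n
  ... | phase₁₂ k e ¬o = trans
    (v₁₂ (K + k) (E-+p k n e) (¬o ∘ E-∸p (suc k) (n + b) ∘ shifted))
    (trans (cong code₁₂ (J-+p k n)) (sym (v₁₂ k e ¬o)))
    where
    shifted : E (suc (K + k)) (n + p + b) → E (K + suc k) (n + b + p)
    shifted = subst₂ E (sym (+-suc K k)) (swap n p b)
  ... | phase₀₃ k o ¬e = trans
    (v₀₃ (K + k) (subst₂ E (+-suc K k) (swap n b p) (E-+p (suc k) (n + b) o))
      (¬e ∘ E-∸p (suc k) n ∘ subst (λ i → E i (n + p)) (sym (+-suc K k))))
    (trans (cong code₀₃ (trans (cong (λ i → J i (n + p)) (sym (+-suc K k))) (J-+p (suc k) n)))
      (sym (v₀₃ k o ¬e)))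

  -- The value 1 excludes 03-runs, and inside the same 12-run `n` would have value 1 or 2. Starts of
  -- 12-runs are thus visible in the values, and every period must respect them.
  rise⇒start : ∀ {n} → origin ≤ n + a → v (n + a) ≡ 1 → v n ≡ 0 →
               ∃[ k ] E k (n + a) × ¬ O k (n + a) × ¬ E k n
  rise⇒start {n} o≤n+a v≡1 v≡0 with phase o≤n+a
  ... | phase₀₃ k o ¬e = contradiction (trans (sym v≡1) (v₀₃ k o ¬e)) (1≢code₀₃ _)
    where
    1≢code₀₃ : ∀ j → 1 ≢ code₀₃ j
    1≢code₀₃ true  ()
    1≢code₀₃ false ()
  ... | phase₁₂ k e ¬o = k , e , ¬o , λ e′ →
    0≢code₁₂ _ (trans (sym v≡0) (v₁₂ k e′
      (¬o ∘ subst (E (suc k)) (swap n b a) ∘ E-+a (suc k) (n + b))))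
    where
    0≢code₁₂ : ∀ j → 0 ≢ code₁₂ j
    0≢code₁₂ true  ()
    0≢code₁₂ false ()

  module _ (n : ℕ) (n<o : n < origin) (o≤n+a : origin ≤ n + a) where

    ¬E₀ : ¬ E 0 n
    ¬E₀ e = <⇒≱ n<o (E₀⇒ e)

    first-ones : v (n + a) ≡ 1
    first-ones = trans (v₁₂ 0 (⇒E₀ o≤n+a) (¬E₀ ∘ +a+b⇒E 0 n))
      (cong code₁₂ (J-start 0 n (⇒E₀ o≤n+a) ¬E₀))

    -- `n` is among the last `a` sink positions; shifted by `p` it ends the 03-run of index `K-1`.
    last-zeros : v (n + p) ≡ 0
    last-zeros = trans
      (v₀₃ K-1
        (subst₂ E (+-identityʳ K) (swap n b p) (E-+p 0 (n + b) (E-+a⇒+b 0 n (⇒E₀ o≤n+a))))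
        (¬E₀ ∘ E-∸p 0 n ∘ subst (λ i → E i (n + p)) (sym (+-identityʳ K))))
      (cong code₀₃ (begin
        J K (n + p)        ≡⟨ cong (λ i → J i (n + p)) (sym (+-identityʳ K)) ⟩
        J (K + 0) (n + p)  ≡⟨ J-+p 0 n ⟩
        J 0 n              ≡⟨ J-before-start 0 n (⇒E₀ o≤n+a) ¬E₀ ⟩
        false              ∎))
      where open ≡-Reasoning

  -- The starts are `a - 1` apart. Were the indices different, a shift by `b - a + 1` or `b + a - 1`
  -- from the start of larger index would show that the other start is already past its 12-run.
  start-unique : ∀ {k k′ n m} → suc m ≡ n + a →
                 E k (n + a) → ¬ O k (n + a) → ¬ E k n →
                 E k′ (m + a) → ¬ O k′ (m + a) → ¬ E k′ m → k ≡ k′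
  start-unique {k} {k′} {n} {m} 1+m≡n+a e ¬o ¬e e′ ¬o′ ¬e′ with <-cmp k k′
  ... | tri≈ _ k≡k′ _ = k≡k′
  ... | tri< k<k′ _ _ = contradiction
    (subst (E (suc k)) eq (E-+ (suc k) (m + a) (suc (b ∸ a))
      (≤-trans (m≤n+m∸n b a) (+-monoʳ-≤ a (n≤1+n _))) (E-anti _ k<k′ e′))) ¬o
    where
    eq : m + a + suc (b ∸ a) ≡ n + a + b
    eq = begin
      m + a + suc (b ∸ a)    ≡⟨ rearrange m a (b ∸ a) ⟩
      suc m + (a + (b ∸ a))  ≡⟨ cong₂ _+_ 1+m≡n+a (m+[n∸m]≡n a≤b) ⟩
      n + a + b              ∎
      where
      open ≡-Reasoning
      rearrange : ∀ m a d → m + a + suc d ≡ suc m + (a + d)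
      rearrange = solve-∀
  ... | tri> _ _ k′<k = contradiction
    (subst (E (suc k′)) eq (E-+ (suc k′) (n + a) (pred a + b)
      (≤-trans (m≤n+m b (pred a)) (m≤n+m _ a)) (E-anti _ k′<k e))) ¬o′
    where
    eq : n + a + (pred a + b) ≡ m + a + b
    eq = begin
      n + a + (pred a + b)   ≡⟨ cong (_+ (pred a + b)) 1+m≡n+a ⟨
      suc m + (pred a + b)   ≡⟨ rearrange m (pred a) b ⟩
      m + suc (pred a) + b   ≡⟨ cong (λ z → m + z + b) (suc-pred a) ⟩
      m + a + b              ∎
      where
      open ≡-Reasoning
      rearrange : ∀ m a d → suc m + (a + d) ≡ m + suc a + d
      rearrange = solve-∀

  -- A block of `a` zeros followed by `a` ones recurs after the shift by `q`, and `aligned` locates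
  -- it. The shift by `p` comes first because the zeros before the origin lie in the sink, where `q`
  -- says nothing.
  p∣period : ∀ q → (∀ {n} → origin ≤ n → v (n + q) ≡ v n) → p ∣ q
  p∣period q per = result
    where
    a≤o : a ≤ origin
    a≤o = ≤-trans (m≤m+n a b) a+b≤o
    n₀ m₀ : ℕ
    n₀ = origin ∸ a
    m₀ = pred origin
    instance
      o≢0 : NonZero origin
      o≢0 = >-nonZero (≤-trans (>-nonZero⁻¹ a) a≤o)
    n₀+a≡o : n₀ + a ≡ origin
    n₀+a≡o = m∸n+n≡m a≤o
    1+m₀≡n₀+a : suc m₀ ≡ n₀ + a
    1+m₀≡n₀+a = trans (suc-pred origin) (sym n₀+a≡o)
    n₀≤m₀ : n₀ ≤ m₀
    n₀≤m₀ = ≤-pred (subst (suc n₀ ≤_) (sym 1+m₀≡n₀+a) (m<m+n n₀ (>-nonZero⁻¹ a)))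
    starts : ∀ n → n < origin → n₀ ≤ n →
             ∃[ k ] E k (n + p + q + a) × ¬ O k (n + p + q + a) × ¬ E k (n + p + q)
    starts n n<o n₀≤n = rise⇒start
      (≤-trans o≤n+a (≤-trans (m≤m+n (n + a) (p + q)) (≤-reflexive (sym shift₁))))
      (begin
        v (n + p + q + a)   ≡⟨ cong v (rearrange n p q a) ⟩
        v (n + a + p + q)   ≡⟨ per (≤-trans o≤n+a (m≤m+n (n + a) p)) ⟩
        v (n + a + p)       ≡⟨ periodic o≤n+a ⟩
        v (n + a)           ≡⟨ first-ones n n<o o≤n+a ⟩
        1                   ∎)
      (trans (per (≤-trans o≤n+a (+-monoʳ-≤ n a≤p))) (last-zeros n n<o o≤n+a))
      where
      open ≡-Reasoning
      o≤n+a : origin ≤ n + a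
      o≤n+a = subst (_≤ n + a) n₀+a≡o (+-monoˡ-≤ a n₀≤n)
      rearrange : ∀ n p q a → n + p + q + a ≡ n + a + p + q
      rearrange = solve-∀
      shift₁ : n + p + q + a ≡ n + a + (p + q)
      shift₁ = trans (rearrange n p q a) (+-assoc (n + a) p q)
    sucs : suc (m₀ + p + q) ≡ n₀ + p + q + a
    sucs = trans (cong (λ z → z + p + q) 1+m₀≡n₀+a) (rearrange n₀ a p q)
      where
      rearrange : ∀ n a p q → n + a + p + q ≡ n + p + q + a
      rearrange = solve-∀
    starts-n₀ = starts n₀ (subst (n₀ <_) n₀+a≡o (m<m+n n₀ (>-nonZero⁻¹ a))) ≤-refl
    starts-m₀ = starts m₀ (≤-reflexive (suc-pred origin)) n₀≤m₀
    p∣q : ∃[ t ] n₀ + p + q + a ≡ origin + t * p → p ∣ q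
    p∣q (t , eq) = ∣m+n∣m⇒∣n (divides t (+-cancelˡ-≡ origin _ _ (begin
      origin + (p + q)   ≡⟨ cong (_+ (p + q)) n₀+a≡o ⟨
      n₀ + a + (p + q)   ≡⟨ rearrange n₀ a p q ⟩
      n₀ + p + q + a     ≡⟨ eq ⟩
      origin + t * p     ∎))) ∣-refl
      where
      open ≡-Reasoning
      rearrange : ∀ n a p q → n + a + (p + q) ≡ n + p + q + a
      rearrange = solve-∀
    result : p ∣ q
    result =
      let k , e , ¬o , ¬e = starts-n₀
          k′ , e′ , ¬o′ , ¬e′ = starts-m₀
          k≡k′ = start-unique {k} {k′} sucs e ¬o ¬e e′ ¬o′ ¬e′
      in p∣q (aligned k sucs e ¬e (subst (λ i → E i (m₀ + p + q + a)) (sym k≡k′) e′)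
                (¬e′ ∘ subst (λ i → E i (m₀ + p + q)) k≡k′))

-- Transfer between the game and the shifted positions.

module Shift {a δ p : ℕ} .{{_ : NonZero a}} (Φ : PhaseSystem a (a + δ) p) (u : ℕ → ℕ)
  (u-zero : u 0 ≡ 0)
  (u-mex : ∀ j → u (suc j) ≡
           mex (u (suc j ∸ a) ∷ u (suc j ∸ (a + δ)) ∷ u (suc j ∸ (2 * a + δ)) ∷ []))
  where

  open PhaseSystem Φ using (origin)

  -- Truncated subtraction collapses the sink to position 0.
  v : ℕ → ℕ
  v n = u (suc n ∸ origin)

  v-sink : ∀ {n} → n < origin → v n ≡ 0
  v-sink n<o = trans (cong u (m≤n⇒m∸n≡0 n<o)) u-zero

  v-origin+ : ∀ j → v (origin + j) ≡ u (suc j)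
  v-origin+ j = cong u (trans (cong (_∸ origin) (sym (+-suc origin j)))
    (m+n∸m≡n origin (suc j)))

  v-shift : ∀ j q → v (origin + j + q) ≡ u (suc j + q)
  v-shift j q = trans (cong v (+-assoc origin j q)) (v-origin+ (j + q))

  u-option : ∀ j s {y} → origin + j ≡ y + s → u (suc j ∸ s) ≡ v y
  u-option j s {y} o+j≡y+s = cong u (begin
    suc j ∸ s                    ≡⟨ cong (_∸ s) (m+n∸m≡n origin (suc j)) ⟨
    origin + suc j ∸ origin ∸ s
      ≡⟨ cong (λ z → z ∸ origin ∸ s) (trans (+-suc origin j) (cong suc o+j≡y+s)) ⟩
    suc y + s ∸ origin ∸ s       ≡⟨ ∸-+-assoc (suc y + s) origin s ⟩
    suc y + s ∸ (origin + s)     ≡⟨ cong₂ _∸_ (+-comm (suc y) s) (+-comm origin s) ⟩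
    s + suc y ∸ (s + origin)     ≡⟨ [m+n]∸[m+o]≡n∸o s (suc y) origin ⟩
    suc y ∸ origin               ∎)
    where open ≡-Reasoning

  v-mex : ∀ n → origin ≤ n + a + (a + δ) → v (n + a + (a + δ)) ≡
          mex (v (n + (a + δ)) ∷ v (n + a) ∷ v n ∷ [])
  v-mex n o≤x = begin
    v x             ≡⟨ cong v o+j≡x ⟨
    v (origin + j)  ≡⟨ v-origin+ j ⟩
    u (suc j)       ≡⟨ u-mex j ⟩
    mex (u (suc j ∸ a) ∷ u (suc j ∸ (a + δ)) ∷ u (suc j ∸ (2 * a + δ)) ∷ [])
      ≡⟨ cong mex (cong₂ _∷_ (u-option j a (trans o+j≡x (swap n a (a + δ))))
           (cong₂ _∷_ (u-option j (a + δ) o+j≡x)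
             (cong₂ _∷_ (u-option j (2 * a + δ) (trans o+j≡x (collect n a δ))) refl))) ⟩
    mex (v (n + (a + δ)) ∷ v (n + a) ∷ v n ∷ []) ∎
    where
    open ≡-Reasoning
    x = n + a + (a + δ)
    j = x ∸ origin
    o+j≡x : origin + j ≡ x
    o+j≡x = m+[n∸m]≡n o≤x
    collect : ∀ n a δ → n + a + (a + δ) ≡ n + (2 * a + δ)
    collect = solve-∀

  open Values Φ v v-sink v-mex using (periodic; p∣period)

  u-periodic : ∀ j → u (suc j + p) ≡ u (suc j)
  u-periodic j = begin
    u (suc j + p)       ≡⟨ v-shift j p ⟨
    v (origin + j + p)  ≡⟨ periodic (m≤m+n origin j) ⟩
    v (origin + j)      ≡⟨ v-origin+ j ⟩
    u (suc j)           ∎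
    where open ≡-Reasoning

  p∣u-period : ∀ q → (∀ j → u (suc j + q) ≡ u (suc j)) → p ∣ q
  p∣u-period q per = p∣period q λ {n} o≤n →
    subst (λ n → v (n + q) ≡ v n) (m+[n∸m]≡n o≤n) (begin
      v (origin + (n ∸ origin) + q)  ≡⟨ v-shift (n ∸ origin) q ⟩
      u (suc (n ∸ origin) + q)       ≡⟨ per (n ∸ origin) ⟩
      u (suc (n ∸ origin))           ≡⟨ v-origin+ (n ∸ origin) ⟨
      v (origin + (n ∸ origin))      ∎)
    where open ≡-Reasoning

nimValue-option : ∀ S j s → nimValue S (ℤ.+ j ℤ.- ℤ.+ s) ≡ nimValue S (ℤ.+ (j ∸ s))
nimValue-option S j s with s ≤? j
... | yes s≤j = cong (nimValue S) (trans (ℤ.m-n≡m⊖n j s) (ℤ.⊖-≥ s≤j))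
... | no  s≰j = trans
  (nimValue-sink S (ℤ.i≤j⇒i-j≤0 (ℤ.+≤+ (<⇒≤ (≰⇒> s≰j)))))
  (cong (λ i → nimValue S (ℤ.+ i)) (sym (m≤n⇒m∸n≡0 (<⇒≤ (≰⇒> s≰j)))))

module _ (m δ : ℕ) .{{_ : NonZero m}} where

  private
    S = additiveSet m δ

    u : ℕ → ℕ
    u j = nimValue S (ℤ.+ j)

  additive-mex : ∀ j → u (suc j) ≡
    mex (u (suc j ∸ m) ∷ u (suc j ∸ (m + δ)) ∷ u (suc j ∸ (2 * m + δ)) ∷ [])
  additive-mex j = trans
    (nimValue-mex S>0 {+[1+ j ]} (ℤ.+≤+ (s≤s z≤n)))
    (cong mex (cong₂ _∷_ (nimValue-option S (suc j) m)
      (cong₂ _∷_ (nimValue-option S (suc j) (m + δ))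
        (cong₂ _∷_ (nimValue-option S (suc j) (2 * m + δ)) refl))))
    where
    m+n≢0 : ∀ k n .{{_ : NonZero k}} → NonZero (k + n)
    m+n≢0 (suc k) n = _
    m>0 : NonZero m
    m>0 = >-nonZero (>-nonZero⁻¹ m)
    S>0 = m>0 ∷ m+n≢0 m δ ∷ m+n≢0 (2 * m) δ {{m*n≢0 2 m}} ∷ []

  PhaseSystem⇒purelyPeriodic : ∀ {p} → PhaseSystem m (m + δ) p →
                               PurelyPeriodicWithLength (nimValue S) p
  PhaseSystem⇒purelyPeriodic {p} Φ =
    ≤-trans (>-nonZero⁻¹ m) (PhaseSystem.a≤p Φ) , isPeriod , minimal
    where
    open Shift Φ u refl additive-mex using (u-periodic; p∣u-period)
    isPeriod : IsPeriod (nimValue S) p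
    isPeriod +[1+ j ] _ = u-periodic j
    isPeriod (ℤ.+ zero) (ℤ.+≤+ ())
    minimal : ∀ q → 1 ≤ q → IsPeriod (nimValue S) q → p ≤ q
    minimal q 1≤q per = ∣⇒≤ {{>-nonZero 1≤q}}
      (p∣u-period q (λ j → per +[1+ j ] (ℤ.+≤+ (s≤s z≤n))))

-- The case d ≤ m.

module _ {a b r : ℕ} (H : ℕ) .{{_ : NonZero a}}
  (a≤b : a ≤ b) (r≤a : r ≤ a) (b+r≡2aH : b + r ≡ H * (2 * a)) where

  private
    -- The slope `2 * H` raises the threshold by `2 (b + r)` per `k`; the constant `suc H` puts the
    -- origin at `b + r + 2 a`, which leaves room for the longest move.
    L : ℕ → ℕ
    L k = k * (2 * H) + suc H

    a+b≤o : a + b ≤ suc H * (2 * a)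
    a+b≤o = +-mono-≤ (m≤m+n a _) (subst (b ≤_) b+r≡2aH (m≤m+n b r))

    L-suc : ∀ k → L (suc k) * (2 * a) ≡ L k * (2 * a) + 2 * (b + r)
    L-suc k = trans (expand k H a)
      (cong (λ z → L k * (2 * a) + 2 * z) (sym b+r≡2aH))
      where
      expand : ∀ k H a → (suc k * (2 * H) + suc H) * (2 * a) ≡
               (k * (2 * H) + suc H) * (2 * a) + 2 * (H * (2 * a))
      expand = solve-∀

    L-linear : ∀ k → L k * (2 * a) ≡ L 0 * (2 * a) + k * (2 * (b + r))
    L-linear k = trans (expand k H a)
      (cong (λ z → L 0 * (2 * a) + k * (2 * z)) (sym b+r≡2aH))
      where
      expand : ∀ k H a → (k * (2 * H) + suc H) * (2 * a) ≡
               suc H * (2 * a) + k * (2 * (H * (2 * a)))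
      expand = solve-∀

  -- Here r = m − d, and n has phase at least 2k when n ≥ origin + k (2b + r);
  -- adding k r to both sides makes the threshold a multiple of 2a.
  straightSystem : PhaseSystem a b (b + b + r)
  straightSystem = record
    { F       = λ k n → n + k * r
    ; L       = L
    ; ε       = r
    ; K-1     = 0
    ; a≤b     = a≤b
    ; a≤p     = ≤-trans a≤b (≤-trans (m≤m+n b b) (m≤m+n (b + b) r))
    ; a+b≤o   = a+b≤o
    ; ε≤a     = r≤a
    ; F-+a    = λ k n → swap n a (k * r)
    ; F-+2b   = λ k n → trans (eq₁ n b r k (L k * (2 * a)))
                              (cong (n + k * r +_) (sym (L-suc k)))
    ; J-+b    = λ k n → evenBlock-cong a 0 H (trans (eq₂ n b r k)
                              (cong (n + k * r +_) b+r≡2aH))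
    ; E-+     = λ k n s _ e → ≤-trans e (+-monoˡ-≤ (k * r) (m≤m+n n s))
    ; E₀⇒     = λ {n} → subst (L 0 * (2 * a) ≤_) (+-identityʳ n)
    ; ⇒E₀     = λ {n} → subst (L 0 * (2 * a) ≤_) (sym (+-identityʳ n))
    ; F-+p    = λ k n → trans (eq₃ n b r k (L k * (2 * a)))
                              (cong (n + k * r +_) (sym (L-suc k)))
    -- As `m + 1 = n + a`, the conditions `E k (n + a)` and `¬ E k m` squeeze the threshold to a
    -- single value; the witness is `k` itself.
    ; aligned = λ k {n} {m} 1+m≡n+a e _ _ ¬e → k , +-cancelʳ-≡ (k * r) _ _
        (trans (≤-antisym (subst (λ z → z + k * r ≤ L k * (2 * a)) 1+m≡n+a (≰⇒> ¬e)) e)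
               (trans (L-linear k) (eq₄ (L 0 * (2 * a)) k b r)))
    }
    where
    eq₁ : ∀ n b r k c → n + b + b + suc k * r + r + c ≡ n + k * r + (c + 2 * (b + r))
    eq₁ = solve-∀
    eq₂ : ∀ n b r k → n + b + suc k * r + 0 ≡ n + k * r + (b + r)
    eq₂ = solve-∀
    eq₃ : ∀ n b r k c → n + (b + b + r) + suc k * r + c ≡ n + k * r + (c + 2 * (b + r))
    eq₃ = solve-∀
    eq₄ : ∀ o k b r → o + k * (2 * (b + r)) ≡ o + k * (b + b + r) + k * r
    eq₄ = solve-∀

-- Reversal within blocks.

module _ (a : ℕ) .{{_ : NonZero a}} where

  -- Reverses each block [s a, s a + a) in place.
  reverse : ℕ → ℕ
  reverse n = n / a * a + (a ∸ suc (n % a))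

  reverse-digits : ∀ s {i j} → suc (i + j) ≡ a → reverse (s * a + i) ≡ s * a + j
  reverse-digits s {i} {j} 1+i+j≡a = cong₂ (λ q r → q * a + (a ∸ suc r)) quot rem-i
    ⟨ trans ⟩ cong (s * a +_) (trans (cong (_∸ suc i) (sym 1+i+j≡a)) (m+n∸m≡n (suc i) j))
    where
    i<a : i < a
    i<a = subst (i <_) 1+i+j≡a (s≤s (m≤m+n i j))
    quot : (s * a + i) / a ≡ s
    quot = trans (+-distrib-/-∣ˡ i (n∣m*n s))
      (trans (cong₂ _+_ (m*n/n≡m s a) (m<n⇒m/n≡0 i<a)) (+-identityʳ s))
    rem-i : (s * a + i) % a ≡ i
    rem-i = trans (cong (_% a) (+-comm (s * a) i))
      (trans ([m+kn]%n≡m%n i s a) (m<n⇒m%n≡m i<a))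

  digits : ∀ n → ∃[ s ] ∃[ i ] ∃[ j ] suc (i + j) ≡ a × n ≡ s * a + i
  digits n = n / a , n % a , a ∸ suc (n % a) , m+[n∸m]≡n (m%n<n n a) ,
    trans (m≡m%n+[m/n]*n n a) (+-comm (n % a) _)

  reverse-+ta : ∀ n t → reverse (n + t * a) ≡ reverse n + t * a
  reverse-+ta n t with digits n
  ... | s , i , j , 1+i+j≡a , refl = begin
    reverse (s * a + i + t * a)  ≡⟨ cong reverse (gather s a i t) ⟩
    reverse ((s + t) * a + i)    ≡⟨ reverse-digits (s + t) 1+i+j≡a ⟩
    (s + t) * a + j              ≡⟨ gather s a j t ⟨
    s * a + j + t * a            ≡⟨ cong (_+ t * a) (reverse-digits s 1+i+j≡a) ⟨
    reverse (s * a + i) + t * a  ∎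
    where
    open ≡-Reasoning
    gather : ∀ s a i t → s * a + i + t * a ≡ (s + t) * a + i
    gather = solve-∀

  reverse-+a : ∀ n → reverse (n + a) ≡ reverse n + a
  reverse-+a n = subst (λ z → reverse (n + z) ≡ reverse n + z) (*-identityˡ a) (reverse-+ta n 1)

  -- A point and its mirror image have a sum fixed by their block. So modulo `2 a` reversal is
  -- negation up to a constant, which controls it under shifts that break the blocks.
  n+reverse-n : ∀ n → suc (n + reverse n) ≡ n / a * (2 * a) + a
  n+reverse-n n = begin
    suc (n + reverse n)                          ≡⟨ cong (λ z → suc (z + reverse n)) (m≡m%n+[m/n]*n n a) ⟩
    suc (n % a + n / a * a + reverse n)          ≡⟨ rearrange (n % a) (n / a) a (a ∸ suc (n % a)) ⟩
    n / a * (2 * a) + (suc (n % a) + (a ∸ suc (n % a)))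
      ≡⟨ cong (n / a * (2 * a) +_) (m+[n∸m]≡n (m%n<n n a)) ⟩
    n / a * (2 * a) + a                          ∎
    where
    open ≡-Reasoning
    rearrange : ∀ i s a j → suc (i + s * a + (s * a + j)) ≡ s * (2 * a) + (suc i + j)
    rearrange = solve-∀

  block≤reverse : ∀ n → n / a * a ≤ reverse n
  block≤reverse n = m≤m+n _ _

  reverse<block : ∀ n → reverse n < suc (n / a) * a
  reverse<block n = subst (reverse n <_) (+-comm (n / a * a) a)
    (+-monoʳ-< (n / a * a) (∸-monoʳ-< (s≤s z≤n) (m%n<n n a)))

  ta≤n⇒ta≤reverse : ∀ t {n} → t * a ≤ n → t * a ≤ reverse n
  ta≤n⇒ta≤reverse t {n} ta≤n = ≤-trans
    (*-monoˡ-≤ a (subst (_≤ n / a) (m*n/n≡m t a) (/-monoˡ-≤ a ta≤n)))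
    (block≤reverse n)

  ta≤reverse⇒ta≤n : ∀ t {n} → t * a ≤ reverse n → t * a ≤ n
  ta≤reverse⇒ta≤n t {n} ta≤rev = ≤-trans
    (*-monoˡ-≤ a (≤-pred (*-cancelʳ-< a t (suc (n / a)) (≤-<-trans ta≤rev (reverse<block n)))))
    (m/n*n≤m n a)

  -- Such a shift leads to a later block, and reversal keeps the order of blocks.
  reverse-+-mono : ∀ n {s} → a ≤ s → reverse n ≤ reverse (n + s)
  reverse-+-mono n {s} a≤s = <⇒≤ (<-≤-trans (reverse<block n) (≤-trans
    (*-monoˡ-≤ a (subst (_≤ (n + s) / a) ([m+a]/a≡1+m/a a n)
      (/-monoˡ-≤ a (+-monoʳ-≤ n a≤s))))
    (block≤reverse (n + s))))

  -- reverse jumps up by a + 1 from n to n + (a − 1), unless n is the first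
  -- point of a block.
  reverse-jump : ∀ {n m x} → suc m ≡ n + a →
                 x ≤ reverse n + a → reverse n < x → x ≤ reverse m + a → reverse m < x →
                 x ≡ n + a × a ∣ n
  reverse-jump {n} {m} {x} 1+m≡n+a x≤ <x x≤′ <x′ with digits n
  -- `n` opens block `s` and `m` closes it, so the bounds `reverse n + 1` and `reverse m + a` on `x`
  -- coincide.
  ... | s , zero , j , 1+j≡a , refl = ≤-antisym
      (≤-trans x≤′ (≤-reflexive (trans (cong (_+ a) rev-m) (cong (_+ a) (sym (+-identityʳ (s * a)))))))
      (≤-trans (≤-reflexive eq) <x)
    , divides s (+-identityʳ (s * a))
    where
    m≡ : m ≡ s * a + j
    m≡ = suc-injective (begin
      suc m              ≡⟨ 1+m≡n+a ⟩
      s * a + 0 + a      ≡⟨ cong (s * a + 0 +_) 1+j≡a ⟨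
      s * a + 0 + suc j  ≡⟨ rearrange (s * a) j ⟩
      suc (s * a + j)    ∎)
      where
      open ≡-Reasoning
      rearrange : ∀ x j → x + 0 + suc j ≡ suc (x + j)
      rearrange = solve-∀
    rev-m : reverse m ≡ s * a
    rev-m = trans (cong reverse m≡) (trans
      (reverse-digits s (trans (cong suc (+-identityʳ j)) 1+j≡a)) (+-identityʳ (s * a)))
    eq : s * a + 0 + a ≡ suc (reverse (s * a + 0))
    eq = begin
      s * a + 0 + a              ≡⟨ cong (_+ a) (+-identityʳ (s * a)) ⟩
      s * a + a                  ≡⟨ cong (s * a +_) 1+j≡a ⟨
      s * a + suc j              ≡⟨ +-suc (s * a) j ⟩
      suc (s * a + j)            ≡⟨ cong suc (reverse-digits s 1+j≡a) ⟨
      suc (reverse (s * a + 0))  ∎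
      where open ≡-Reasoning
  ... | s , suc i , j , 2+i+j≡a , refl = contradiction (≤-<-trans x≤ lt) (<⇒≯ <x′)
    where
    m≡ : m ≡ suc s * a + i
    m≡ = suc-injective (trans 1+m≡n+a (rearrange s a i))
      where
      rearrange : ∀ s a i → s * a + suc i + a ≡ suc (suc s * a + i)
      rearrange = solve-∀
    rev-m : reverse m ≡ suc s * a + suc j
    rev-m = trans (cong reverse m≡) (reverse-digits (suc s) (trans (cong suc (+-suc i j)) 2+i+j≡a))
    lt : reverse (s * a + suc i) + a < reverse m
    lt = ≤-reflexive (begin
      suc (reverse (s * a + suc i) + a)  ≡⟨ cong (λ z → suc (z + a)) (reverse-digits s 2+i+j≡a) ⟩
      suc (s * a + j + a)                ≡⟨ rearrange s a j ⟩
      suc s * a + suc j                  ≡⟨ rev-m ⟨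
      reverse m                          ∎)
      where
      open ≡-Reasoning
      rearrange : ∀ s a j → suc (s * a + j + a) ≡ suc s * a + suc j
      rearrange = solve-∀

-- The case d > m.

module _ {a b e r : ℕ} (H K-1 : ℕ) .{{_ : NonZero a}}
  (2a≤b : a + a ≤ b) (e≤a : e ≤ a) (r+e≡2a : r + e ≡ 2 * a) (b+r≡2aH : b + r ≡ H * (2 * a))
  (a∣Ke : a ∣ suc K-1 * e) (a∣kr⇒K∣k : ∀ k → a ∣ k * r → suc K-1 ∣ k) where

  private
    K : ℕ
    K = suc K-1

    -- Here b ≡ e and r ≡ − e modulo 2a. Phase 2k begins when
    -- reverse (n − 2kb) ≥ origin + k e; adding 2k (b + r) inside and k r outside
    -- removes the subtractions and makes the threshold a multiple of 2a.
    arg : ℕ → ℕ → ℕ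
    arg k n = n + 2 * (k * r)

    F : ℕ → ℕ → ℕ
    F k n = reverse a (arg k n) + k * r

    -- The slope counts the multiples of `2 a` in `2 (b + r) + (r + e)`.
    L : ℕ → ℕ
    L k = k * suc (2 * H) + suc H

    c : ℕ → ℕ
    c k = L k * (2 * a)

    E : ℕ → ℕ → Set
    E k n = c k ≤ F k n

    F-+a : ∀ k n → F k (n + a) ≡ F k n + a
    F-+a k n = begin
      reverse a (n + a + 2 * (k * r)) + k * r  ≡⟨ cong (λ z → reverse a z + k * r) (swap n a _) ⟩
      reverse a (arg k n + a) + k * r          ≡⟨ cong (_+ k * r) (reverse-+a a (arg k n)) ⟩
      reverse a (arg k n) + a + k * r          ≡⟨ swap _ a (k * r) ⟩
      F k n + a                                ∎
      where open ≡-Reasoning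

    c-+ : ∀ j k → c (j + k) ≡ c k + j * (4 * H * a + 2 * a)
    c-+ j k = expand j k H a
      where
      expand : ∀ j k H a → ((j + k) * suc (2 * H) + suc H) * (2 * a) ≡
               (k * suc (2 * H) + suc H) * (2 * a) + j * (4 * H * a + 2 * a)
      expand = solve-∀

    F-+t : ∀ j k n s t → n + s + 2 * ((j + k) * r) ≡ arg k n + t * a →
           F (j + k) (n + s) ≡ F k n + (t * a + j * r)
    F-+t j k n s t eq = begin
      reverse a (n + s + 2 * ((j + k) * r)) + (j + k) * r
        ≡⟨ cong (λ z → reverse a z + (j + k) * r) eq ⟩
      reverse a (arg k n + t * a) + (j + k) * r
        ≡⟨ cong (_+ (j + k) * r) (reverse-+ta a (arg k n) t) ⟩
      reverse a (arg k n) + t * a + (j + k) * r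
        ≡⟨ rearrange (reverse a (arg k n)) (t * a) j k r ⟩
      F k n + (t * a + j * r) ∎
      where
      open ≡-Reasoning
      rearrange : ∀ x y j k r → x + y + (j + k) * r ≡ x + k * r + (y + j * r)
      rearrange = solve-∀

    F-+2b : ∀ k n → F (suc k) (n + b + b) + e + c k ≡ F k n + c (suc k)
    F-+2b k n = begin
      F (suc k) (n + b + b) + e + c k
        ≡⟨ cong (λ z → z + e + c k) (trans (cong (F (suc k)) (+-assoc n b b)) (F-+t 1 k n (b + b) (4 * H) eq)) ⟩
      F k n + (4 * H * a + 1 * r) + e + c k
        ≡⟨ rearrange₁ (F k n) (4 * H * a) r e (c k) ⟩
      F k n + (c k + (4 * H * a + (r + e)))
        ≡⟨ cong (λ z → F k n + (c k + (4 * H * a + z))) r+e≡2a ⟩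
      F k n + (c k + (4 * H * a + 2 * a))
        ≡⟨ cong (λ z → F k n + (c k + z)) (*-identityˡ (4 * H * a + 2 * a)) ⟨
      F k n + (c k + 1 * (4 * H * a + 2 * a))
        ≡⟨ cong (F k n +_) (c-+ 1 k) ⟨
      F k n + c (suc k) ∎
      where
      open ≡-Reasoning
      rearrange₁ : ∀ x y r e c → x + (y + 1 * r) + e + c ≡ x + (c + (y + (r + e)))
      rearrange₁ = solve-∀
      rearrange₂ : ∀ n b k r → n + (b + b) + 2 * ((1 + k) * r) ≡ n + 2 * (k * r) + 2 * (b + r)
      rearrange₂ = solve-∀
      rearrange₃ : ∀ x H a → x + 2 * (H * (2 * a)) ≡ x + 4 * H * a
      rearrange₃ = solve-∀
      eq : n + (b + b) + 2 * ((1 + k) * r) ≡ arg k n + 4 * H * a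
      eq = trans (rearrange₂ n b k r)
        (trans (cong (λ z → arg k n + 2 * z) b+r≡2aH) (rearrange₃ (arg k n) H a))

    -- The argument of `reverse` moves by `K (2 (b + r) + e)`, a whole number of blocks because `a`
    -- divides `K * e`.
    F-+p : ∀ k n → F (K + k) (n + K * (b + b + e)) + c k ≡ F k n + c (K + k)
    F-+p k n = begin
      F (K + k) (n + K * (b + b + e)) + c k
        ≡⟨ cong (_+ c k) (F-+t K k n (K * (b + b + e)) (K * (4 * H) + q) eq) ⟩
      F k n + ((K * (4 * H) + q) * a + K * r) + c k
        ≡⟨ rearrange₁ (F k n) K H q a r (c k) ⟩
      F k n + (c k + (K * (4 * H * a) + (K * r + q * a)))
        ≡⟨ cong (λ z → F k n + (c k + (K * (4 * H * a) + (K * r + z)))) Ke≡qa ⟨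
      F k n + (c k + (K * (4 * H * a) + (K * r + K * e)))
        ≡⟨ cong (λ z → F k n + (c k + z)) (rearrange₂ K (4 * H * a) r e) ⟩
      F k n + (c k + K * (4 * H * a + (r + e)))
        ≡⟨ cong (λ z → F k n + (c k + K * (4 * H * a + z))) r+e≡2a ⟩
      F k n + (c k + K * (4 * H * a + 2 * a))
        ≡⟨ cong (F k n +_) (c-+ K k) ⟨
      F k n + c (K + k) ∎
      where
      open ≡-Reasoning
      q = quotient a∣Ke
      Ke≡qa : K * e ≡ q * a
      Ke≡qa = _∣_.equality a∣Ke
      rearrange₁ : ∀ x K H q a r c → x + ((K * (4 * H) + q) * a + K * r) + c ≡
                   x + (c + (K * (4 * H * a) + (K * r + q * a)))
      rearrange₁ = solve-∀
      rearrange₂ : ∀ K y r e → K * y + (K * r + K * e) ≡ K * (y + (r + e))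
      rearrange₂ = solve-∀
      rearrange₃ : ∀ n b e K k r → n + K * (b + b + e) + 2 * ((K + k) * r) ≡
                   n + 2 * (k * r) + (K * (2 * (b + r)) + K * e)
      rearrange₃ = solve-∀
      rearrange₄ : ∀ x K H a q → x + (K * (2 * (H * (2 * a))) + q * a) ≡ x + (K * (4 * H) + q) * a
      rearrange₄ = solve-∀
      eq : n + K * (b + b + e) + 2 * ((K + k) * r) ≡ arg k n + (K * (4 * H) + q) * a
      eq = trans (rearrange₃ n b e K k r) (trans
        (cong₂ (λ y z → arg k n + (K * (2 * y) + z)) b+r≡2aH Ke≡qa)
        (rearrange₄ (arg k n) K H a q))

    -- The argument moves by `b + 2 r`, which need not be whole blocks. By `n+reverse-n` the
    -- reversal changes by `- (b + 2 r)` modulo `2 a`; the outer summand adds `r`, and the total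
    -- `- (b + r)` vanishes.
    J-+b : ∀ k n → evenBlock a (F (suc k) (n + b)) ≡ evenBlock a (F k n)
    J-+b k n = evenBlock-cong a (H + s₀) s₁ (+-cancelʳ-≡ (suc (z₁ + a)) _ _ (begin
      R₁ + suc k * r + (H + s₀) * (2 * a) + suc (z₁ + a)
        ≡⟨ rearrange₁ R₁ k r H s₀ a z₁ ⟩
      suc (z₁ + R₁) + (s₀ * (2 * a) + a) + (k * r + r + H * (2 * a))
        ≡⟨ cong₂ (λ x y → x + y + (k * r + r + H * (2 * a))) (n+reverse-n a z₁) (sym (n+reverse-n a z₀)) ⟩
      s₁ * (2 * a) + a + suc (z₀ + R₀) + (k * r + r + H * (2 * a))
        ≡⟨ cong (λ x → s₁ * (2 * a) + a + suc (z₀ + R₀) + (k * r + r + x)) b+r≡2aH ⟨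
      s₁ * (2 * a) + a + suc (z₀ + R₀) + (k * r + r + (b + r))
        ≡⟨ rearrange₂ s₁ a n k r R₀ b ⟩
      R₀ + k * r + s₁ * (2 * a) + suc (z₁ + a) ∎))
      where
      open ≡-Reasoning
      z₀ = arg k n
      z₁ = arg (suc k) (n + b)
      R₀ = reverse a z₀
      R₁ = reverse a z₁
      s₀ = z₀ / a
      s₁ = z₁ / a
      rearrange₁ : ∀ R k r H s a z → R + suc k * r + (H + s) * (2 * a) + suc (z + a) ≡
                   suc (z + R) + (s * (2 * a) + a) + (k * r + r + H * (2 * a))
      rearrange₁ = solve-∀
      rearrange₂ : ∀ s a n k r R b →
        s * (2 * a) + a + suc (n + 2 * (k * r) + R) + (k * r + r + (b + r)) ≡
        R + k * r + s * (2 * a) + suc (n + b + 2 * (suc k * r) + a)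
      rearrange₂ = solve-∀

    E-+ : ∀ k n s → b ≤ a + s → E k n → E k (n + s)
    E-+ k n s b≤a+s e = ≤-trans e (+-monoˡ-≤ (k * r)
      (≤-trans (reverse-+-mono a (arg k n) (+-cancelˡ-≤ a a s (≤-trans 2a≤b b≤a+s)))
        (≤-reflexive (cong (reverse a) (swap n (2 * (k * r)) s)))))

    F₀≡reverse : ∀ n → F 0 n ≡ reverse a n
    F₀≡reverse n = trans (+-identityʳ _) (cong (reverse a) (+-identityʳ n))

    c₀≡ : c 0 ≡ 2 * suc H * a
    c₀≡ = expand H a
      where
      expand : ∀ H a → suc H * (2 * a) ≡ 2 * suc H * a
      expand = solve-∀

    E₀⇒ : ∀ {n} → E 0 n → c 0 ≤ n
    E₀⇒ {n} e = subst (_≤ n) (sym c₀≡)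
      (ta≤reverse⇒ta≤n a (2 * suc H) (subst₂ _≤_ c₀≡ (F₀≡reverse n) e))

    ⇒E₀ : ∀ {n} → c 0 ≤ n → E 0 n
    ⇒E₀ {n} o≤n = subst₂ _≤_ (sym c₀≡) (sym (F₀≡reverse n))
      (ta≤n⇒ta≤reverse a (2 * suc H) (subst (_≤ n) c₀≡ o≤n))

    aligned : ∀ k {n m} → suc m ≡ n + a →
              E k (n + a) → ¬ E k n → E k (m + a) → ¬ E k m →
              ∃[ t ] n + a ≡ c 0 + t * (K * (b + b + e))
    aligned k {n} {m} 1+m≡n+a en ¬en em ¬em
      with reverse-jump a {arg k n} {arg k m} {c k ∸ k * r} sucs
             (below k n en) (above k n ¬en) (below k m em) (above k m ¬em)
      where
      sucs : suc (arg k m) ≡ arg k n + a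
      sucs = trans (cong (_+ 2 * (k * r)) 1+m≡n+a) (swap n a _)
      below : ∀ k n → E k (n + a) → c k ∸ k * r ≤ reverse a (arg k n) + a
      below k n e = m≤n+o⇒m∸n≤o (c k) (k * r) (≤-trans e (≤-reflexive
        (trans (F-+a k n) (rearrange (reverse a (arg k n)) (k * r) a))))
        where
        rearrange : ∀ x y a → x + y + a ≡ y + (x + a)
        rearrange = solve-∀
      above : ∀ k n → ¬ E k n → reverse a (arg k n) < c k ∸ k * r
      above k n ¬e = m+n≤o⇒m≤o∸n (suc (reverse a (arg k n))) (≰⇒> ¬e)
    -- `c k` and `arg k n + a` are multiples of `a`, hence so is `k * r`. This forces `k` to be a
    -- multiple of `K`, and `t` is the quotient.
    ... | c∸kr≡ , a∣arg = result (a∣kr⇒K∣k k a∣kr)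
      where
      kr≤c : k * r ≤ c k
      kr≤c = ≤-trans (m≤n+m (k * r) _) (<⇒≤ (≰⇒> ¬en))
      c≡ : c k ≡ arg k n + a + k * r
      c≡ = trans (sym (m∸n+n≡m kr≤c)) (cong (_+ k * r) c∸kr≡)
      a∣kr : a ∣ k * r
      a∣kr = ∣m+n∣m⇒∣n (subst (a ∣_) c≡ (∣n⇒∣m*n (L k) (n∣m*n 2)))
        (∣m∣n⇒∣m+n a∣arg ∣-refl)
      n+a≡ : n + a ≡ c 0 + k * (b + b + e)
      n+a≡ = +-cancelʳ-≡ (3 * (k * r)) _ _ (begin
        n + a + 3 * (k * r)                             ≡⟨ rearrange₁ n a k r ⟩
        arg k n + a + k * r                             ≡⟨ c≡ ⟨
        c k                                             ≡⟨ cong c (+-identityʳ k) ⟨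
        c (k + 0)                                       ≡⟨ c-+ k 0 ⟩
        c 0 + k * (4 * H * a + 2 * a)                   ≡⟨ cong (c 0 +_) (rearrange₂ k H a) ⟩
        c 0 + k * (2 * (H * (2 * a)) + 2 * a)           ≡⟨ cong₂ (λ x y → c 0 + k * (2 * x + y)) b+r≡2aH r+e≡2a ⟨
        c 0 + k * (2 * (b + r) + (r + e))               ≡⟨ rearrange₃ (c 0) k b r e ⟩
        c 0 + k * (b + b + e) + 3 * (k * r)             ∎)
        where
        open ≡-Reasoning
        rearrange₁ : ∀ n a k r → n + a + 3 * (k * r) ≡ n + 2 * (k * r) + a + k * r
        rearrange₁ = solve-∀
        rearrange₂ : ∀ k H a → k * (4 * H * a + 2 * a) ≡ k * (2 * (H * (2 * a)) + 2 * a)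
        rearrange₂ = solve-∀
        rearrange₃ : ∀ o k b r e → o + k * (2 * (b + r) + (r + e)) ≡ o + k * (b + b + e) + 3 * (k * r)
        rearrange₃ = solve-∀
      result : K ∣ k → ∃[ t ] n + a ≡ c 0 + t * (K * (b + b + e))
      result (divides t k≡tK) = t , trans n+a≡
        (cong (c 0 +_) (trans (cong (_* (b + b + e)) k≡tK) (*-assoc t K (b + b + e))))

  reversingSystem : PhaseSystem a b (suc K-1 * (b + b + e))
  reversingSystem = record
    { F       = F
    ; L       = L
    ; ε       = e
    ; K-1     = K-1
    ; a≤b     = ≤-trans (m≤m+n a a) 2a≤b
    ; a≤p     = ≤-trans (≤-trans (m≤m+n a a) 2a≤b) (≤-trans (m≤m+n b b)
                  (≤-trans (m≤m+n (b + b) e) (m≤n*m (b + b + e) K)))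
    ; a+b≤o   = +-mono-≤ (m≤m+n a _) (subst (b ≤_) b+r≡2aH (m≤m+n b r))
    ; ε≤a     = e≤a
    ; F-+a    = F-+a
    ; F-+2b   = F-+2b
    ; J-+b    = J-+b
    ; E-+     = E-+
    ; E₀⇒     = E₀⇒
    ; ⇒E₀     = ⇒E₀
    ; F-+p    = F-+p
    ; aligned = aligned
    }

-- Choice of parameters and conclusion.

module _ {a d : ℕ} (j : ℕ) .{{_ : NonZero a}} where

  δ : ℕ
  δ = d + j * (2 * a)

  phaseSystem-d≤a : d ≤ a → PhaseSystem a (a + δ) (3 * a + 2 * δ ∸ d)
  phaseSystem-d≤a d≤a = subst (PhaseSystem a (a + δ)) period
    (straightSystem (suc j) (m≤m+n a δ) (m∸n≤m a d) b+r)
    where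
    open ≡-Reasoning
    b+r : a + δ + (a ∸ d) ≡ suc j * (2 * a)
    b+r = begin
      a + δ + (a ∸ d)                   ≡⟨ rearrange a d (j * (2 * a)) (a ∸ d) ⟩
      a + (d + (a ∸ d)) + j * (2 * a)   ≡⟨ cong (λ z → a + z + j * (2 * a)) (m+[n∸m]≡n d≤a) ⟩
      a + a + j * (2 * a)               ≡⟨ collect a j ⟩
      suc j * (2 * a)                   ∎
      where
      rearrange : ∀ a d x r → a + (d + x) + r ≡ a + (d + r) + x
      rearrange = solve-∀
      collect : ∀ a j → a + a + j * (2 * a) ≡ suc j * (2 * a)
      collect = solve-∀
    period : a + δ + (a + δ) + (a ∸ d) ≡ 3 * a + 2 * δ ∸ d
    period = begin
      a + δ + (a + δ) + (a ∸ d)   ≡⟨ +-∸-assoc (a + δ + (a + δ)) d≤a ⟨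
      a + δ + (a + δ) + a ∸ d     ≡⟨ cong (_∸ d) (collect a δ) ⟩
      3 * a + 2 * δ ∸ d           ∎
      where
      collect : ∀ a δ → a + δ + (a + δ) + a ≡ 3 * a + 2 * δ
      collect = solve-∀

  phaseSystem-a<d : .{{_ : NonZero (gcd a d)}} → a < d → d < 2 * a →
                    PhaseSystem a (a + δ) (a * (a + 2 * δ + d) / gcd a d)
  phaseSystem-a<d a<d d<2a = subst (PhaseSystem a (a + δ)) period
    (reversingSystem (suc (suc j)) (pred K) 2a≤b e≤a r+e b+r
      (subst (λ k → a ∣ k * e) (sym 1+pK≡K) a∣Ke)
      (λ k → subst (_∣ k) (sym 1+pK≡K) ∘ a∣kr⇒K∣k k))
    where
    open ≡-Reasoning
    g = gcd a d
    K = a / g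
    D = d / g
    e = d ∸ a
    -- `a - d` would be negative, so `2 a` is added; this raises `H` to `j + 2`.
    r = 3 * a ∸ d
    instance
      K≢0 : NonZero K
      K≢0 = ≢-nonZero (m/gcd[m,n]≢0 a d)
    1+pK≡K : suc (pred K) ≡ K
    1+pK≡K = suc-pred K
    Kg≡a : K * g ≡ a
    Kg≡a = m/n*n≡m (gcd[m,n]∣m a d)
    Dg≡d : D * g ≡ d
    Dg≡d = m/n*n≡m (gcd[m,n]∣n a d)
    a+e≡d : a + e ≡ d
    a+e≡d = m+[n∸m]≡n (<⇒≤ a<d)
    d+r≡3a : d + r ≡ 3 * a
    d+r≡3a = m+[n∸m]≡n (≤-trans (<⇒≤ d<2a) (*-monoˡ-≤ a (n≤1+n 2)))
    2a≤b : a + a ≤ a + δ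
    2a≤b = +-monoʳ-≤ a (≤-trans (<⇒≤ a<d) (m≤m+n d _))
    e≤a : e ≤ a
    e≤a = m≤n+o⇒m∸n≤o d a (≤-trans (<⇒≤ d<2a) (≤-reflexive (cong (a +_) (+-identityʳ a))))
    r+e : r + e ≡ 2 * a
    r+e = +-cancelˡ-≡ a _ _ (begin
      a + (r + e)   ≡⟨ rearrange a r e ⟩
      a + e + r     ≡⟨ cong (_+ r) a+e≡d ⟩
      d + r         ≡⟨ d+r≡3a ⟩
      a + 2 * a     ∎)
      where
      rearrange : ∀ a r e → a + (r + e) ≡ a + e + r
      rearrange = solve-∀
    b+r : a + δ + r ≡ suc (suc j) * (2 * a)
    b+r = begin
      a + δ + r                       ≡⟨ rearrange a d (j * (2 * a)) r ⟩
      a + (d + r) + j * (2 * a)       ≡⟨ cong (λ z → a + z + j * (2 * a)) d+r≡3a ⟩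
      a + 3 * a + j * (2 * a)         ≡⟨ collect a j ⟩
      suc (suc j) * (2 * a)           ∎
      where
      rearrange : ∀ a d x r → a + (d + x) + r ≡ a + (d + r) + x
      rearrange = solve-∀
      collect : ∀ a j → a + 3 * a + j * (2 * a) ≡ suc (suc j) * (2 * a)
      collect = solve-∀
    a∣Kd : a ∣ K * d
    a∣Kd = divides D (begin
      K * d         ≡⟨ cong (K *_) Dg≡d ⟨
      K * (D * g)   ≡⟨ rearrange K D g ⟩
      D * (K * g)   ≡⟨ cong (D *_) Kg≡a ⟩
      D * a         ∎)
      where
      rearrange : ∀ K D g → K * (D * g) ≡ D * (K * g)
      rearrange = solve-∀
    a∣Ke : a ∣ K * e
    a∣Ke = ∣m+n∣m⇒∣n (subst (a ∣_) (begin
      K * d           ≡⟨ cong (K *_) a+e≡d ⟨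
      K * (a + e)     ≡⟨ *-distribˡ-+ K a e ⟩
      K * a + K * e   ∎) a∣Kd) (n∣m*n K)
    -- Modulo `a`, `r` is `- d`, so `a` divides `k * d`. Dividing by the gcd leaves `K` dividing
    -- `D * k` with `K` and `D` coprime.
    a∣kr⇒K∣k : ∀ k → a ∣ k * r → K ∣ k
    a∣kr⇒K∣k k a∣kr = coprime-divisor (coprime-/gcd a d) (*-cancelʳ-∣ g
      (subst₂ _∣_ (sym Kg≡a) kd≡ a∣kd))
      where
      a∣kd : a ∣ k * d
      a∣kd = ∣m+n∣m⇒∣n (subst (a ∣_) (begin
        k * (3 * a)     ≡⟨ cong (k *_) d+r≡3a ⟨
        k * (d + r)     ≡⟨ *-distribˡ-+ k d r ⟩
        k * d + k * r   ≡⟨ +-comm (k * d) (k * r) ⟩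
        k * r + k * d   ∎) (∣n⇒∣m*n k (n∣m*n 3))) a∣kr
      kd≡ : k * d ≡ D * k * g
      kd≡ = begin
        k * d         ≡⟨ cong (k *_) Dg≡d ⟨
        k * (D * g)   ≡⟨ rearrange k D g ⟩
        D * k * g     ∎
        where
        rearrange : ∀ k D g → k * (D * g) ≡ D * k * g
        rearrange = solve-∀
    period : suc (pred K) * (a + δ + (a + δ) + e) ≡ a * (a + 2 * δ + d) / g
    period = begin
      suc (pred K) * (a + δ + (a + δ) + e)   ≡⟨ cong (_* (a + δ + (a + δ) + e)) 1+pK≡K ⟩
      K * (a + δ + (a + δ) + e)              ≡⟨ cong (K *_) (rearrange a δ e) ⟩
      K * (a + 2 * δ + (a + e))              ≡⟨ cong (λ z → K * (a + 2 * δ + z)) a+e≡d ⟩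
      K * W                                  ≡⟨ m*n/n≡m (K * W) g ⟨
      K * W * g / g                          ≡⟨ cong (_/ g) (*-right-comm K W g) ⟩
      K * g * W / g                          ≡⟨ cong (λ z → z * W / g) Kg≡a ⟩
      a * W / g                              ∎
      where
      W = a + 2 * δ + d
      rearrange : ∀ a δ e → a + δ + (a + δ) + e ≡ a + 2 * δ + (a + e)
      rearrange = solve-∀
      *-right-comm : ∀ x y z → x * y * z ≡ x * z * y
      *-right-comm = solve-∀

theorem3 : (m δ : ℕ) .{{_ : NonZero m}} .{{_ : NonZero δ}} →
    PurelyPeriodicWithLength (nimValue (additiveSet m δ)) (periodLength m δ)
theorem3 m δ = PhaseSystem⇒purelyPeriodic m δ phaseSystem
  where
  instance
    2m≢0 : NonZero (2 * m)
    2m≢0 = m*n≢0 2 m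
    gcd≢0 : NonZero (gcd m (residue m δ))
    gcd≢0 = ≢-nonZero (gcd[m,n]≢0 m (residue m δ) (inj₁ (≢-nonZero⁻¹ m)))
  d = residue m δ
  j = δ / (2 * m)
  δ≡d+2jm : δ ≡ d + j * (2 * m)
  δ≡d+2jm = m≡m%n+[m/n]*n δ (2 * m)
  phaseSystem : PhaseSystem m (m + δ) (periodLength m δ)
  phaseSystem with d ≤? m
  -- Only the explicit occurrences of `δ` are rewritten; the residue `d` stays fixed.
  ... | yes d≤m = subst (λ δ → PhaseSystem m (m + δ) (3 * m + 2 * δ ∸ d))
    (sym δ≡d+2jm) (phaseSystem-d≤a j d≤m)
  ... | no  d≰m = subst (λ δ → PhaseSystem m (m + δ) (m * (m + 2 * δ + d) / gcd m d))
    (sym δ≡d+2jm) (phaseSystem-a<d j (≰⇒> d≰m) (m%n<n δ (2 * m)))
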